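{- Let $M\in\mathbb F_2^{n\times n}$ be a symmetric matrix. Then $\operatorname{diag}(M)\in\operatorname{Im}(M)$. Moreover, the solution set \[ \mathcal S(M)=\{x\in\mathbb F_2^n : Mx=\operatorname{diag}(M)\} \] is a nonempty affine subspace of $\mathbb F_2^n$ of dimension $n-\operatorname{rank}(M)$, and every $x\in\mathcal S(M)$ satisfies \[ \operatorname{diag}(M)^T x\equiv \operatorname{rank}(M)\pmod 2 . \]
   Context: All matrices and vector spaces are over the two-element field $\mathbb F_2$. For a square matrix $M$, $\operatorname{diag}(M)\in\mathbb F_2^n$ denotes its diagonal vector $(M_{11},\dots,M_{nn})^T$ and $\operatorname{Im}(M)$ its column space. A congruence modulo 2 between an element of $\mathbb F_2$ and an integer means that the element equals the image of the integer in $\mathbb F_2$. -}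

module Defs where

open import Algebra.Bundles using (CommutativeRing)
open import Data.Empty using (⊥-elim)
open import Data.Fin.Base using (zero; suc)
open import Data.Fin.Properties using (all?)
open import Data.Nat.Base as ℕ using (ℕ; zero; suc; z≤n; s≤s)
import Data.Nat.Properties as ℕ
open import Data.Parity.Base using (Parity; 0ℙ; 1ℙ)
open import Data.Parity.Properties using (_≟_; +-*-commutativeRing)
open import Data.Product.Base using (∃; ∃-syntax; _×_; _,_; proj₁; proj₂)
open import Data.Vec.Functional using (Vector; _∷_; head; tail; transpose)
open import Function.Bundles using (_⇔_)
open import Level using (0ℓ)
open import Relation.Binary.PropositionalEquality
open import Relation.Nullary using (¬_; Dec; yes; no)
open import Relation.Unary using (Pred; _∈_; _∉_; _⊆_)

open CommutativeRing +-*-commutativeRing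
  using (_+_; _*_; _-_; 0#; semiring; distribʳ; +-identityʳ)
open import Algebra.Properties.Semiring.Sum semiring

-- The two-element field is the library's Parity, and the image in it of a
-- natural number is Data.Nat.Base.parity.  Vectors and matrices are functions
-- on Fin n, so equality of vectors is the pointwise equality _≗_.

𝔽₂ : Set
𝔽₂ = Parity

Matrix : ℕ → ℕ → Set
Matrix m n = Vector (Vector 𝔽₂ n) m

private
  variable
    m n k d : ℕ

IsSymmetric : Matrix n n → Set
IsSymmetric M = ∀ i j → M i j ≡ M j i

diag : Matrix n n → Vector 𝔽₂ n
diag M i = M i i

infixr 7 _*ᵥ_
infix  7 _∙_
infixr 7 _·ᵥ_
infixl 6 _+ᵥ_ _-ᵥ_

_∙_ : Vector 𝔽₂ n → Vector 𝔽₂ n → 𝔽₂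
x ∙ y = sum λ i → x i * y i

_*ᵥ_ : Matrix m n → Vector 𝔽₂ n → Vector 𝔽₂ m
(M *ᵥ x) i = M i ∙ x

0ᵥ : Vector 𝔽₂ n
0ᵥ i = 0#

_+ᵥ_ _-ᵥ_ : Vector 𝔽₂ n → Vector 𝔽₂ n → Vector 𝔽₂ n
(x +ᵥ y) i = x i + y i
(x -ᵥ y) i = x i - y i

_·ᵥ_ : 𝔽₂ → Vector 𝔽₂ n → Vector 𝔽₂ n
(a ·ᵥ x) i = a * x i

linComb : Vector 𝔽₂ k → Vector (Vector 𝔽₂ n) k → Vector 𝔽₂ n
linComb c vs i = sum λ j → c j * vs j i

Span : Vector (Vector 𝔽₂ n) k → Pred (Vector 𝔽₂ n) 0ℓ
Span vs x = ∃[ c ] x ≗ linComb c vs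

LinearlyIndependent : Vector (Vector 𝔽₂ n) k → Set
LinearlyIndependent vs = ∀ c → linComb c vs ≗ 0ᵥ → c ≗ 0ᵥ

record IsSubspace (V : Pred (Vector 𝔽₂ n) 0ℓ) : Set where
  field
    resp-≗    : ∀ {x y} → x ≗ y → x ∈ V → y ∈ V
    0ᵥ-mem    : 0ᵥ ∈ V
    +ᵥ-closed : ∀ {x y} → x ∈ V → y ∈ V → (x +ᵥ y) ∈ V
    ·ᵥ-closed : ∀ a {x} → x ∈ V → (a ·ᵥ x) ∈ V

record IsBasis (V : Pred (Vector 𝔽₂ n) 0ℓ) (bs : Vector (Vector 𝔽₂ n) d) : Set where
  field
    members     : ∀ j → bs j ∈ V
    independent : LinearlyIndependent bs
    spanning    : V ⊆ Span bs

HasDimension : Pred (Vector 𝔽₂ n) 0ℓ → ℕ → Set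
HasDimension V d = ∃[ bs ] IsBasis {d = d} V bs

-- A = base + direction, with direction a linear subspace of dimension d;
-- in particular A is nonempty.
record IsAffineSubspaceOfDim (A : Pred (Vector 𝔽₂ n) 0ℓ) (d : ℕ) : Set₁ where
  field
    base          : Vector 𝔽₂ n
    base-mem      : base ∈ A
    direction     : Pred (Vector 𝔽₂ n) 0ℓ
    isSubspace    : IsSubspace direction
    hasDimension  : HasDimension direction d
    mem⇔direction : ∀ x → x ∈ A ⇔ (x -ᵥ base) ∈ direction

-- transpose M is the family of columns of M.
Im : Matrix m n → Pred (Vector 𝔽₂ m) 0ℓ
Im M = Span (transpose M)

𝒮 : Matrix n n → Pred (Vector 𝔽₂ n) 0ℓ
𝒮 M x = M *ᵥ x ≗ diag M

-- Every finitely generated span has a basis; this makes rank a function.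

linComb-congˡ : {c c′ : Vector 𝔽₂ k} (vs : Vector (Vector 𝔽₂ n) k) →
                c ≗ c′ → linComb c vs ≗ linComb c′ vs
linComb-congˡ vs c≗c′ i = sum-cong-≗ λ j → cong (_* vs j i) (c≗c′ j)

linComb-0 : (vs : Vector (Vector 𝔽₂ n) k) → linComb 0ᵥ vs ≗ 0ᵥ
linComb-0 {k = k} vs i = sum-replicate-zero k

∃-vector? : (P : Pred (Vector 𝔽₂ k) 0ℓ) → (∀ {c c′} → c ≗ c′ → P c → P c′) →
            (∀ c → Dec (P c)) → Dec (∃ P)
∃-vector? {zero} P resp P? with P? 0ᵥ
... | yes p = yes (0ᵥ , p)
... | no ¬p = no λ (c , p) → ¬p (resp (λ ()) p)
∃-vector? {suc k} P resp P? with extend? 0ℙ | extend? 1ℙ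
  where
  extend? : ∀ a → Dec (∃ λ c → P (a ∷ c))
  extend? a = ∃-vector? (λ c → P (a ∷ c))
    (λ c≗c′ → resp λ { zero → refl ; (suc j) → c≗c′ j })
    (λ c → P? (a ∷ c))
... | yes (c , p) | _           = yes (0ℙ ∷ c , p)
... | no _        | yes (c , p) = yes (1ℙ ∷ c , p)
... | no ¬p₀      | no ¬p₁      = no none
  where
  η : (c : Vector 𝔽₂ (suc k)) → c ≗ (head c ∷ tail c)
  η c zero    = refl
  η c (suc j) = refl

  none : ¬ ∃ P
  none (c , p) with head c | resp (η c) p
  ... | 0ℙ | q = ¬p₀ (tail c , q)
  ... | 1ℙ | q = ¬p₁ (tail c , q)

span? : (vs : Vector (Vector 𝔽₂ n) k) (x : Vector 𝔽₂ n) → Dec (x ∈ Span vs)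
span? vs x = ∃-vector? (λ c → x ≗ linComb c vs)
  (λ c≗c′ eq i → trans (eq i) (linComb-congˡ vs c≗c′ i))
  (λ c → all? λ i → x i ≟ linComb c vs i)

span-∷ : (v : Vector 𝔽₂ n) (vs : Vector (Vector 𝔽₂ n) k) → Span vs ⊆ Span (v ∷ vs)
span-∷ v vs (c , eq) = 0ℙ ∷ c , eq

independent-∷ : (v : Vector 𝔽₂ n) (vs : Vector (Vector 𝔽₂ n) k) →
                v ∉ Span vs → LinearlyIndependent vs → LinearlyIndependent (v ∷ vs)
independent-∷ v vs v∉ ind c eq with c zero in c₀
... | 0ℙ = λ { zero → c₀ ; (suc j) → ind (tail c) eq j }
... | 1ℙ = ⊥-elim (v∉ (tail c , λ i → cancel (v i) _ (eq i)))
  where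
  cancel : ∀ a b → a + b ≡ 0# → a ≡ b
  cancel 0ℙ 0ℙ _ = refl
  cancel 1ℙ 1ℙ _ = refl

spanBasis : (vs : Vector (Vector 𝔽₂ n) k) → ∃[ d ] d ℕ.≤ k × HasDimension (Span vs) d
spanBasis {k = zero} vs = 0 , z≤n , vs , record
  { members     = λ ()
  ; independent = λ c _ ()
  ; spanning    = λ (c , eq) → 0ᵥ , eq
  }
spanBasis {k = suc k} vs with spanBasis (tail vs)
... | d , d≤k , bs , isBasis with span? bs (head vs)
...   | yes (c , v≗) = d , ℕ.m≤n⇒m≤1+n d≤k , bs , record
  { members     = λ j → span-∷ (head vs) (tail vs) (members j)
  ; independent = independent
  ; spanning    = spanning′
  }
  where
  open IsBasis isBasis
  spanning′ : Span vs ⊆ Span bs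
  spanning′ {x} (a , eq) with a zero | spanning (tail a , λ i → refl)
  ... | 0ℙ | b , tail≗ = b , λ i → trans (eq i) (tail≗ i)
  ... | 1ℙ | b , tail≗ = (c +ᵥ b) , λ i → begin
    x i                                                    ≡⟨ eq i ⟩
    head vs i + linComb (tail a) (tail vs) i               ≡⟨ cong₂ _+_ (v≗ i) (tail≗ i) ⟩
    linComb c bs i + linComb b bs i                        ≡⟨ ∑-distrib-+ (λ j → c j * bs j i) (λ j → b j * bs j i) ⟨
    (sum λ j → c j * bs j i + b j * bs j i)                ≡⟨ sum-cong-≗ (λ j → distribʳ (bs j i) (c j) (b j)) ⟨
    linComb (c +ᵥ b) bs i                                  ∎
    where open ≡-Reasoning
...   | no v∉ = suc d , s≤s d≤k , (head vs ∷ bs) , record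
  { members     = λ { zero    → (1ℙ ∷ 0ᵥ) , λ i →
                        sym (trans (cong (head vs i +_) (linComb-0 (tail vs) i)) (+-identityʳ _))
                    ; (suc j) → span-∷ (head vs) (tail vs) (members j) }
  ; independent = independent-∷ (head vs) bs v∉ independent
  ; spanning    = λ (a , eq) → let (b , tail≗) = spanning (tail a , λ i → refl) in
                    (head a ∷ b) , λ i → trans (eq i) (cong (head a * head vs i +_) (tail≗ i))
  }
  where open IsBasis isBasis

rank : Matrix m n → ℕ
rank M = proj₁ (spanBasis (transpose M))

rank-dim-Im : (M : Matrix m n) → HasDimension (Im M) (rank M)
rank-dim-Im M = proj₂ (proj₂ (spanBasis (transpose M)))

-- Hence the truncated subtraction n ∸ rank M is the ordinary difference.
rank≤n : (M : Matrix m n) → rank M ℕ.≤ n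
rank≤n M = proj₁ (proj₂ (spanBasis (transpose M)))

{-# OPTIONS --safe #-}
module Submission where

-- For a pivot M i j = 1, subtracting the rank-one matrix (M eⱼ)(eᵢᵀ M) from M
-- (Wedderburn reduction) lowers the rank by one and enlarges the kernel by eⱼ.
-- For symmetric M, a pivot on the diagonal leaves a symmetric M′ with
-- diag M = diag M′ + M eᵢ, and any solution x of M x = diag M has
-- (M eᵢ) ∙ x = 1, so it also solves M′ x = diag M′ and both sides of the parity
-- claim change by one.  When the diagonal vanishes, the claim is that the rank
-- is even: reducing at (i , j) and then at (j , i) keeps M alternating.

open import Defs
open import Algebra.Bundles using (CommutativeRing)
open import Data.Empty using (⊥-elim)
open import Data.Fin.Base using (Fin; zero; suc; funToFin; finToFun; combine)
open import Data.Fin.Properties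
  using (all?; any?; injective⇒≤; funToFin-finToFin; finToFun-funToFin)
open import Data.Nat.Base as ℕ using (ℕ; zero; suc; _∸_; parity; s≤s; z≤n)
import Data.Nat.Properties as ℕ
open import Data.Nat.Induction using (<-wellFounded)
open import Data.Parity.Base using (0ℙ; 1ℙ; _⁻¹)
open import Data.Parity.Properties
  using (_≟_; +-*-commutativeRing; p+p≡0ℙ; suc-homo-⁻¹; ⁻¹-involutive; *-idem)
open import Data.Product.Base using (∃; ∃-syntax; _×_; _,_; proj₁; proj₂)
open import Data.Vec.Functional using (Vector; _∷_; head; tail; transpose)
open import Function.Base using (_∘_)
open import Function.Bundles using (mk⇔)
open import Induction.WellFounded using (Acc; acc)
open import Level using (0ℓ)
open import Relation.Binary.PropositionalEquality
open import Relation.Nullary using (¬_; Dec; yes; no)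
open import Relation.Nullary.Decidable using (_×-dec_; ¬?; decidable-stable)
open import Relation.Unary using (Pred; _∈_; _∉_; _⊆_; Satisfiable)

open CommutativeRing +-*-commutativeRing
  using (_+_; _*_; semiring; *-comm; *-assoc; distribˡ; distribʳ; +-identityʳ;
         *-identityʳ; zeroʳ; +-assoc; +-comm)
open import Algebra.Properties.Semiring.Sum semiring

private
  variable
    m n k d d′ : ℕ

-- Arithmetic in the two-element field.

¬1⇒0 : ∀ {a} → a ≢ 1ℙ → a ≡ 0ℙ
¬1⇒0 {0ℙ} _   = refl
¬1⇒0 {1ℙ} a≢1 = ⊥-elim (a≢1 refl)

1≢0 : 1ℙ ≢ 0ℙ
1≢0 ()

+≡0⇒≡ : ∀ a b → a + b ≡ 0ℙ → a ≡ b
+≡0⇒≡ 0ℙ 0ℙ _ = refl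
+≡0⇒≡ 1ℙ 1ℙ _ = refl

x+[y+x]≡y : ∀ a b → a + (b + a) ≡ b
x+[y+x]≡y 0ℙ 0ℙ = refl
x+[y+x]≡y 0ℙ 1ℙ = refl
x+[y+x]≡y 1ℙ 0ℙ = refl
x+[y+x]≡y 1ℙ 1ℙ = refl

-- Bilinearity of the dot product

∙-cong : {x x′ y y′ : Vector 𝔽₂ n} → x ≗ x′ → y ≗ y′ → x ∙ y ≡ x′ ∙ y′
∙-cong x≗ y≗ = sum-cong-≗ λ i → cong₂ _*_ (x≗ i) (y≗ i)

∙-comm : (x y : Vector 𝔽₂ n) → x ∙ y ≡ y ∙ x
∙-comm x y = sum-cong-≗ λ i → *-comm (x i) (y i)

∙-zeroˡ : (y : Vector 𝔽₂ n) → 0ᵥ ∙ y ≡ 0ℙ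
∙-zeroˡ {n} y = sum-replicate-zero n

∙-zeroʳ : (x : Vector 𝔽₂ n) → x ∙ 0ᵥ ≡ 0ℙ
∙-zeroʳ x = trans (∙-comm x 0ᵥ) (∙-zeroˡ x)

∙-distribʳ-+ᵥ : (x y z : Vector 𝔽₂ n) → (x +ᵥ y) ∙ z ≡ x ∙ z + y ∙ z
∙-distribʳ-+ᵥ x y z = trans (sum-cong-≗ λ i → distribʳ (z i) (x i) (y i))
                            (∑-distrib-+ (λ i → x i * z i) (λ i → y i * z i))

∙-distribˡ-+ᵥ : (x y z : Vector 𝔽₂ n) → x ∙ (y +ᵥ z) ≡ x ∙ y + x ∙ z
∙-distribˡ-+ᵥ x y z = trans (sum-cong-≗ λ i → distribˡ (x i) (y i) (z i))
                            (∑-distrib-+ (λ i → x i * y i) (λ i → x i * z i))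

·ᵥ-∙-assoc : ∀ a (x y : Vector 𝔽₂ n) → (a ·ᵥ x) ∙ y ≡ a * (x ∙ y)
·ᵥ-∙-assoc a x y = trans (sum-cong-≗ λ i → *-assoc a (x i) (y i))
                         (sym (*-distribˡ-sum a (λ i → x i * y i)))

∙-·ᵥ-comm : ∀ (x : Vector 𝔽₂ n) a y → x ∙ (a ·ᵥ y) ≡ a * (x ∙ y)
∙-·ᵥ-comm x a y = trans (∙-comm x (a ·ᵥ y))
                        (trans (·ᵥ-∙-assoc a y x) (cong (a *_) (∙-comm y x)))

unit : Fin n → Vector 𝔽₂ n
unit zero    = 1ℙ ∷ 0ᵥ
unit (suc i) = 0ℙ ∷ unit i

unit-sym : (i j : Fin n) → unit i j ≡ unit j i
unit-sym zero    zero    = refl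
unit-sym zero    (suc j) = refl
unit-sym (suc i) zero    = refl
unit-sym (suc i) (suc j) = unit-sym i j

∙-unit : (x : Vector 𝔽₂ n) (i : Fin n) → x ∙ unit i ≡ x i
∙-unit x zero    = trans (cong₂ _+_ (*-identityʳ (x zero)) (∙-zeroʳ (tail x)))
                         (+-identityʳ (x zero))
∙-unit x (suc i) = cong₂ _+_ (zeroʳ (x zero)) (∙-unit (tail x) i)

-- Subspaces, spans and dimension

Span-isSubspace : (vs : Vector (Vector 𝔽₂ n) k) → IsSubspace (Span vs)
Span-isSubspace vs = record
  { resp-≗    = λ x≗y (c , x≗) → c , λ i → trans (sym (x≗y i)) (x≗ i)
  ; 0ᵥ-mem    = 0ᵥ , λ i → sym (linComb-0 vs i)
  ; +ᵥ-closed = λ (b , x≗) (c , y≗) → b +ᵥ c , λ i →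
      trans (cong₂ _+_ (x≗ i) (y≗ i)) (sym (∙-distribʳ-+ᵥ b c (transpose vs i)))
  ; ·ᵥ-closed = λ a (c , x≗) → a ·ᵥ c , λ i →
      trans (cong (a *_) (x≗ i)) (sym (·ᵥ-∙-assoc a c (transpose vs i)))
  }

module _ {V : Pred (Vector 𝔽₂ n) 0ℓ} (isSubspace : IsSubspace V) where
  open IsSubspace isSubspace

  linComb∈ : (c : Vector 𝔽₂ k) (vs : Vector (Vector 𝔽₂ n) k) →
             (∀ j → vs j ∈ V) → linComb c vs ∈ V
  linComb∈ {k = zero}  c vs vs∈ = 0ᵥ-mem
  linComb∈ {k = suc k} c vs vs∈ =
    +ᵥ-closed (·ᵥ-closed (head c) (vs∈ zero)) (linComb∈ (tail c) (tail vs) (vs∈ ∘ suc))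

  Span⊆ : (vs : Vector (Vector 𝔽₂ n) k) → (∀ j → vs j ∈ V) → Span vs ⊆ V
  Span⊆ vs vs∈ (c , x≗) = resp-≗ (λ i → sym (x≗ i)) (linComb∈ c vs vs∈)

-- In characteristic 2 the difference of `c` and `c′` is `c +ᵥ c′`, and independence is applied to
-- that vector.
linComb-injective : (vs : Vector (Vector 𝔽₂ n) k) → LinearlyIndependent vs →
                    ∀ c c′ → linComb c vs ≗ linComb c′ vs → c ≗ c′
linComb-injective vs ind c c′ eq j = +≡0⇒≡ (c j) (c′ j) (ind (c +ᵥ c′) (λ i → begin
  linComb (c +ᵥ c′) vs i               ≡⟨ ∙-distribʳ-+ᵥ c c′ (transpose vs i) ⟩
  linComb c vs i + linComb c′ vs i     ≡⟨ cong (_+ linComb c′ vs i) (eq i) ⟩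
  linComb c′ vs i + linComb c′ vs i    ≡⟨ p+p≡0ℙ (linComb c′ vs i) ⟩
  0ℙ                                   ∎) j)
  where open ≡-Reasoning

-- Comparing dimensions by counting vectors.

toBit : 𝔽₂ → Fin 2
toBit 0ℙ = zero
toBit 1ℙ = suc zero

fromBit : Fin 2 → 𝔽₂
fromBit zero       = 0ℙ
fromBit (suc zero) = 1ℙ

fromBit-toBit : ∀ a → fromBit (toBit a) ≡ a
fromBit-toBit 0ℙ = refl
fromBit-toBit 1ℙ = refl

toBit-fromBit : ∀ b → toBit (fromBit b) ≡ b
toBit-fromBit zero       = refl
toBit-fromBit (suc zero) = refl

funToFin-cong : {f g : Fin k → Fin m} → f ≗ g → funToFin f ≡ funToFin g
funToFin-cong {k = zero}  f≗g = refl
funToFin-cong {k = suc k} f≗g = cong₂ combine (f≗g zero) (funToFin-cong (f≗g ∘ suc))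

-- Such a map induces an injection Fin (2 ^ k) → Fin (2 ^ d).
injection⇒≤ : (f : Vector 𝔽₂ k → Vector 𝔽₂ d) → (∀ x y → f x ≗ f y → x ≗ y) → k ℕ.≤ d
injection⇒≤ {k} {d} f inj = ℕ.≮⇒≥ λ d<k →
  ℕ.<⇒≱ (ℕ.^-monoʳ-< 2 (s≤s (s≤s z≤n)) d<k) (injective⇒≤ {f = g} (λ {p} {q} → g-injective p q))
  where
  decode : Fin (2 ℕ.^ k) → Vector 𝔽₂ k
  decode p = fromBit ∘ finToFun p

  encode : Vector 𝔽₂ d → Fin (2 ℕ.^ d)
  encode x = funToFin (toBit ∘ x)

  encode-injective : ∀ x y → encode x ≡ encode y → x ≗ y
  encode-injective x y eq i = begin
    x i                                ≡⟨ fromBit-toBit (x i) ⟨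
    fromBit (toBit (x i))              ≡⟨ cong fromBit (finToFun-funToFin (toBit ∘ x) i) ⟨
    fromBit (finToFun (encode x) i)    ≡⟨ cong (λ p → fromBit (finToFun p i)) eq ⟩
    fromBit (finToFun (encode y) i)    ≡⟨ cong fromBit (finToFun-funToFin (toBit ∘ y) i) ⟩
    fromBit (toBit (y i))              ≡⟨ fromBit-toBit (y i) ⟩
    y i                                ∎
    where open ≡-Reasoning

  decode-injective : ∀ p q → decode p ≗ decode q → p ≡ q
  decode-injective p q eq = begin
    p                      ≡⟨ funToFin-finToFin {k} {2} p ⟨
    funToFin (finToFun {2} {k} p)  ≡⟨ funToFin-cong (λ i → trans (sym (toBit-fromBit _))
                               (trans (cong toBit (eq i)) (toBit-fromBit _))) ⟩
    funToFin (finToFun {2} {k} q)  ≡⟨ funToFin-finToFin {k} {2} q ⟩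
    q                      ∎
    where open ≡-Reasoning

  g : Fin (2 ℕ.^ k) → Fin (2 ℕ.^ d)
  g = encode ∘ f ∘ decode

  g-injective : ∀ p q → g p ≡ g q → p ≡ q
  g-injective p q eq =
    decode-injective p q (inj _ _ (encode-injective (f (decode p)) (f (decode q)) eq))

-- Writing combinations of `bs` in terms of `cs` maps coefficient vectors of length `k` to those of
-- length `d`. Independence of `bs` makes this map injective, so counting takes the place of
-- Steinitz exchange.
independent⇒≤ : (bs : Vector (Vector 𝔽₂ n) k) (cs : Vector (Vector 𝔽₂ n) d) →
                LinearlyIndependent bs → (∀ j → bs j ∈ Span cs) → k ℕ.≤ d
independent⇒≤ bs cs ind bs∈ =
  injection⇒≤ (λ c → proj₁ (coordinates c)) λ c c′ eq →
    linComb-injective bs ind c c′ λ i → begin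
      linComb c bs i                         ≡⟨ proj₂ (coordinates c) i ⟩
      linComb (proj₁ (coordinates c)) cs i   ≡⟨ linComb-congˡ cs eq i ⟩
      linComb (proj₁ (coordinates c′)) cs i  ≡⟨ proj₂ (coordinates c′) i ⟨
      linComb c′ bs i                        ∎
  where
  open ≡-Reasoning
  coordinates : ∀ c → linComb c bs ∈ Span cs
  coordinates c = linComb∈ (Span-isSubspace cs) c bs bs∈

-- `rank` is defined through one particular basis of the column space; by uniqueness, any explicit
-- basis of that space determines it.
dimension-unique : {V : Pred (Vector 𝔽₂ n) 0ℓ} →
                   HasDimension V d → HasDimension V d′ → d ≡ d′
dimension-unique (bs , B) (cs , C) = ℕ.≤-antisym
  (independent⇒≤ bs cs B.independent (λ j → C.spanning (B.members j)))
  (independent⇒≤ cs bs C.independent (λ j → B.spanning (C.members j)))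
  where
  module B = IsBasis B
  module C = IsBasis C

linComb-unit : (x : Vector 𝔽₂ n) → x ≗ linComb x unit
linComb-unit x i = sym (trans (∙-cong (λ _ → refl) (λ j → unit-sym j i)) (∙-unit x i))

unit-spans : (x : Vector 𝔽₂ n) → x ∈ Span unit
unit-spans x = x , linComb-unit x

unit-independent : LinearlyIndependent (unit {n})
unit-independent c eq i = trans (linComb-unit c i) (eq i)

-- Existence of bases of decidable subspaces.

module _ {V : Pred (Vector 𝔽₂ n) 0ℓ} (isSubspace : IsSubspace V) (V? : ∀ x → Dec (x ∈ V)) where

  -- Greedy extension with `f` as fuel. Each added vector costs one unit, so running out would leave
  -- `suc n` independent vectors in the span of the `n` unit vectors. The search for a vector
  -- outside the span ranges over the finitely many vectors of length `n`.
  extendToBasis : ∀ f → k ℕ.+ f ≡ suc n → (bs : Vector (Vector 𝔽₂ n) k) →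
                  (∀ j → bs j ∈ V) → LinearlyIndependent bs → ∃ (HasDimension V)
  extendToBasis {k = k} zero k+0≡1+n bs bs∈ ind =
    ⊥-elim (ℕ.<⇒≱ (ℕ.≤-reflexive (trans (sym k+0≡1+n) (ℕ.+-identityʳ k)))
                  (independent⇒≤ bs unit ind (λ j → unit-spans (bs j))))
  extendToBasis {k = k} (suc f) k+f≡n bs bs∈ ind
    with ∃-vector? (λ x → x ∈ V × x ∉ Span bs)
           (λ x≗y (x∈ , x∉) → IsSubspace.resp-≗ isSubspace x≗y x∈ ,
              λ y∈ → x∉ (IsSubspace.resp-≗ (Span-isSubspace bs) (λ i → sym (x≗y i)) y∈))
           (λ x → V? x ×-dec ¬? (span? bs x))
  ... | yes (x , x∈ , x∉) =
        extendToBasis f (trans (sym (ℕ.+-suc k f)) k+f≡n) (x ∷ bs)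
          (λ { zero → x∈ ; (suc j) → bs∈ j }) (independent-∷ x bs x∉ ind)
  ... | no none = k , bs , record
        { members     = bs∈
        ; independent = ind
        ; spanning    = λ {x} x∈ → decidable-stable (span? bs x) (λ x∉ → none (x , x∈ , x∉))
        }

  subspace-dimension : ∃ (HasDimension V)
  subspace-dimension = extendToBasis {k = 0} (suc n) refl (λ ()) (λ ()) (λ _ _ ())

-- Image and kernel

*ᵥ∈Im : (M : Matrix m n) (x : Vector 𝔽₂ n) → (M *ᵥ x) ∈ Im M
*ᵥ∈Im M x = x , λ i → ∙-comm (M i) x

Im⇒*ᵥ : (M : Matrix m n) {y : Vector 𝔽₂ m} → y ∈ Im M → ∃[ x ] y ≗ M *ᵥ x
Im⇒*ᵥ M (x , y≗) = x , λ i → trans (y≗ i) (∙-comm x (M i))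

Ker : Matrix m n → Pred (Vector 𝔽₂ n) 0ℓ
Ker M x = M *ᵥ x ≗ 0ᵥ

Ker-isSubspace : (M : Matrix m n) → IsSubspace (Ker M)
Ker-isSubspace M = record
  { resp-≗    = λ x≗y Mx≗0 i → trans (∙-cong (λ _ → refl) (λ j → sym (x≗y j))) (Mx≗0 i)
  ; 0ᵥ-mem    = λ i → ∙-zeroʳ (M i)
  ; +ᵥ-closed = λ {x} {y} Mx≗0 My≗0 i →
      trans (∙-distribˡ-+ᵥ (M i) x y) (cong₂ _+_ (Mx≗0 i) (My≗0 i))
  ; ·ᵥ-closed = λ a {x} Mx≗0 i →
      trans (∙-·ᵥ-comm (M i) a x) (trans (cong (a *_) (Mx≗0 i)) (zeroʳ a))
  }

Ker-dimension : (M : Matrix m n) → ∃ (HasDimension (Ker M))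
Ker-dimension M = subspace-dimension (Ker-isSubspace M) (λ x → all? λ i → M i ∙ x ≟ 0ℙ)

-- Wedderburn reduction and its effect on image and kernel.

-- The general formula divides by the pivot `M i j` and subtracts; over the two-element field a
-- nonzero pivot is 1 and subtraction is addition.
wedderburn : Matrix m n → Fin m → Fin n → Matrix m n
wedderburn M i j a = M a +ᵥ (M a j ·ᵥ M i)

wedderburn-*ᵥ : ∀ (M : Matrix m n) i j x a →
                (wedderburn M i j *ᵥ x) a ≡ (M *ᵥ x) a + M a j * (M *ᵥ x) i
wedderburn-*ᵥ M i j x a = trans (∙-distribʳ-+ᵥ (M a) (M a j ·ᵥ M i) x)
                                (cong (M a ∙ x +_) (·ᵥ-∙-assoc (M a j) (M i) x))

*ᵥ-shift : ∀ (M : Matrix m n) j x b a →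
           (M *ᵥ (x +ᵥ (b ·ᵥ unit j))) a ≡ (M *ᵥ x) a + b * M a j
*ᵥ-shift M j x b a = trans (∙-distribˡ-+ᵥ (M a) x (b ·ᵥ unit j))
  (cong (M a ∙ x +_) (trans (∙-·ᵥ-comm (M a) b (unit j)) (cong (b *_) (∙-unit (M a) j))))

module _ (M : Matrix m n) {i j} (pivot : M i j ≡ 1ℙ) where

  private
    M′ : Matrix m n
    M′ = wedderburn M i j

  -- The reduction factors as M′ = M (I + eⱼ eᵢᵀ M). This form makes the image of `M′` part of that
  -- of `M` and relates the two kernels.
  wedderburn-shift : ∀ x → M′ *ᵥ x ≗ M *ᵥ (x +ᵥ ((M *ᵥ x) i ·ᵥ unit j))
  wedderburn-shift x a = begin
    (M′ *ᵥ x) a                                 ≡⟨ wedderburn-*ᵥ M i j x a ⟩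
    (M *ᵥ x) a + M a j * (M *ᵥ x) i             ≡⟨ cong ((M *ᵥ x) a +_) (*-comm (M a j) _) ⟩
    (M *ᵥ x) a + (M *ᵥ x) i * M a j             ≡⟨ *ᵥ-shift M j x _ a ⟨
    (M *ᵥ (x +ᵥ ((M *ᵥ x) i ·ᵥ unit j))) a      ∎
    where open ≡-Reasoning

  -- As the pivot is 1, row `i` of `M′` is `M i` added to itself, hence zero. Column `j` of `M` has
  -- the pivot as its entry `i`, so it lies outside `Im M′`.
  wedderburn-pivot-row : ∀ {y} → y ∈ Im M′ → y i ≡ 0ℙ
  wedderburn-pivot-row {y} y∈ with Im⇒*ᵥ M′ y∈
  ... | x , y≗ = begin
    y i                                  ≡⟨ y≗ i ⟩
    (M′ *ᵥ x) i                          ≡⟨ wedderburn-*ᵥ M i j x i ⟩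
    (M *ᵥ x) i + M i j * (M *ᵥ x) i      ≡⟨ cong (λ p → (M *ᵥ x) i + p * (M *ᵥ x) i) pivot ⟩
    (M *ᵥ x) i + (M *ᵥ x) i              ≡⟨ p+p≡0ℙ ((M *ᵥ x) i) ⟩
    0ℙ                                   ∎
    where open ≡-Reasoning

  Im-wedderburn : HasDimension (Im M′) d → HasDimension (Im M) (suc d)
  Im-wedderburn (bs , B) = (transpose M j ∷ bs) , record
    { members     = λ { zero    → unit j , λ a → sym (trans (∙-comm (unit j) (M a)) (∙-unit (M a) j))
                      ; (suc k) → Im′⊆Im (members k) }
    ; independent = independent-∷ (transpose M j) bs
        (λ u∈ → 1≢0 (trans (sym pivot)
          (wedderburn-pivot-row (Span⊆ (Span-isSubspace (transpose M′)) bs members u∈))))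
        independent
    ; spanning    = spanning′
    }
    where
    open IsBasis B

    Im′⊆Im : Im M′ ⊆ Im M
    Im′⊆Im y∈ with Im⇒*ᵥ M′ y∈
    ... | x , y≗ = IsSubspace.resp-≗ (Span-isSubspace (transpose M))
      (λ a → sym (trans (y≗ a) (wedderburn-shift x a))) (*ᵥ∈Im M (x +ᵥ ((M *ᵥ x) i ·ᵥ unit j)))

    spanning′ : Im M ⊆ Span (transpose M j ∷ bs)
    spanning′ {y} y∈ with Im⇒*ᵥ M y∈
    ... | x , y≗ with spanning (*ᵥ∈Im M′ x)
    -- `M′ x` is `M x` plus `(M *ᵥ x) i` times column `j`; adding the same multiple once more gives
    -- back `M x`.
    ...   | c , M′x≗ = ((M *ᵥ x) i ∷ c) , λ a → begin
      y a                                                          ≡⟨ y≗ a ⟩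
      (M *ᵥ x) a
        ≡⟨ x+[y+x]≡y ((M *ᵥ x) i * M a j) _ ⟨
      (M *ᵥ x) i * M a j + ((M *ᵥ x) a + (M *ᵥ x) i * M a j)
        ≡⟨ cong ((M *ᵥ x) i * M a j +_) (*ᵥ-shift M j x _ a) ⟨
      (M *ᵥ x) i * M a j + (M *ᵥ (x +ᵥ ((M *ᵥ x) i ·ᵥ unit j))) a
        ≡⟨ cong ((M *ᵥ x) i * M a j +_) (trans (sym (wedderburn-shift x a)) (M′x≗ a)) ⟩
      (M *ᵥ x) i * M a j + linComb c bs a                          ∎
      where open ≡-Reasoning

  rank-wedderburn : rank M ≡ suc (rank M′)
  rank-wedderburn = dimension-unique (rank-dim-Im M) (Im-wedderburn (rank-dim-Im M′))

  -- `M′` kills everything that `M` kills and also eⱼ, which is new because entry `i` of M eⱼ is the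
  -- pivot. Conversely, if `M′` kills x, then `M` kills x + (M x)ᵢ eⱼ.
  Ker-wedderburn : HasDimension (Ker M) d → HasDimension (Ker M′) (suc d)
  Ker-wedderburn (bs , B) = (unit j ∷ bs) , record
    { members     = λ { zero    → unit∈Ker′ ; (suc k) → Ker⊆Ker′ (members k) }
    ; independent = independent-∷ (unit j) bs
        (λ e∈ → 1≢0 (trans (sym pivot) (trans (sym (∙-unit (M i) j))
          (Span⊆ (Ker-isSubspace M) bs members e∈ i))))
        independent
    ; spanning    = spanning′
    }
    where
    open IsBasis B
    open ≡-Reasoning

    unit∈Ker′ : unit j ∈ Ker M′
    unit∈Ker′ a = begin
      (M′ *ᵥ unit j) a         ≡⟨ ∙-unit (M′ a) j ⟩
      M a j + M a j * M i j    ≡⟨ cong (λ p → M a j + M a j * p) pivot ⟩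
      M a j + M a j * 1ℙ       ≡⟨ cong (M a j +_) (*-identityʳ (M a j)) ⟩
      M a j + M a j            ≡⟨ p+p≡0ℙ (M a j) ⟩
      0ℙ                       ∎

    Ker⊆Ker′ : Ker M ⊆ Ker M′
    Ker⊆Ker′ {x} Mx≗0 a = begin
      (M′ *ᵥ x) a                        ≡⟨ wedderburn-*ᵥ M i j x a ⟩
      (M *ᵥ x) a + M a j * (M *ᵥ x) i    ≡⟨ cong₂ (λ p q → p + M a j * q) (Mx≗0 a) (Mx≗0 i) ⟩
      0ℙ + M a j * 0ℙ                    ≡⟨ zeroʳ (M a j) ⟩
      0ℙ                                 ∎

    spanning′ : Ker M′ ⊆ Span (unit j ∷ bs)
    spanning′ {x} M′x≗0 with spanning (λ a → trans (sym (wedderburn-shift x a)) (M′x≗0 a))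
    -- `y≗` expands the shifted vector in `bs`; the coefficient `(M *ᵥ x) i` undoes the shift along
    -- eⱼ.
    ... | c , y≗ = ((M *ᵥ x) i ∷ c) , λ a → begin
      x a
        ≡⟨ x+[y+x]≡y ((M *ᵥ x) i * unit j a) (x a) ⟨
      (M *ᵥ x) i * unit j a + (x a + (M *ᵥ x) i * unit j a)
        ≡⟨ cong ((M *ᵥ x) i * unit j a +_) (y≗ a) ⟩
      (M *ᵥ x) i * unit j a + linComb c bs a                       ∎

-- Induction on the rank and the rank-nullity theorem.

findPivot : (M : Matrix m n) → Dec (∃[ i ] ∃[ j ] M i j ≡ 1ℙ)
findPivot M = any? λ i → any? λ j → M i j ≟ 1ℙ

module _ (M : Matrix m n) (none : ¬ (∃[ i ] ∃[ j ] M i j ≡ 1ℙ)) where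

  pivotless-*ᵥ : ∀ x → M *ᵥ x ≗ 0ᵥ
  pivotless-*ᵥ x i =
    trans (∙-cong (λ j → ¬1⇒0 (λ Mij≡1 → none (i , j , Mij≡1))) (λ _ → refl)) (∙-zeroˡ x)

  rank-pivotless : rank M ≡ 0
  rank-pivotless = dimension-unique (rank-dim-Im M) ((λ ()) , record
    { members     = λ ()
    ; independent = λ _ _ ()
    ; spanning    = λ y∈ → let (x , y≗) = Im⇒*ᵥ M y∈ in
                      (λ ()) , λ i → trans (y≗ i) (pivotless-*ᵥ x i)
    })

  Ker-pivotless : HasDimension (Ker M) n
  Ker-pivotless = unit , record
    { members     = λ j → pivotless-*ᵥ (unit j)
    ; independent = unit-independent
    ; spanning    = λ {x} _ → unit-spans x
    }

-- Reduction keeps the format of the matrix and lowers only its rank, so the induction is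
-- well-founded on the rank instead of structural in the size.
rank-induction : (P : Matrix m n → Set) →
                 (∀ M → (∀ M′ → rank M′ ℕ.< rank M → P M′) → P M) → ∀ M → P M
rank-induction P step M = go M (<-wellFounded (rank M))
  where
  go : ∀ M → Acc ℕ._<_ (rank M) → P M
  go M (acc rs) = step M λ M′ M′<M → go M′ (rs M′<M)

-- A reduction lowers the rank by one and raises the nullity by one, so the sum is unchanged. At the
-- zero matrix it is `n + 0`.
rank-nullity : ∀ (M : Matrix m n) → HasDimension (Ker M) k → k ℕ.+ rank M ≡ n
rank-nullity {m} {n} M dim = rank-induction P (λ M rec → step M rec (findPivot M)) M _ dim
  where
  P : Matrix m n → Set
  -- The nullity changes along the induction, so `k` is quantified inside `P`.
  P M = ∀ k → HasDimension (Ker M) k → k ℕ.+ rank M ≡ n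

  step : ∀ M → (∀ M′ → rank M′ ℕ.< rank M → P M′) → Dec (∃[ i ] ∃[ j ] M i j ≡ 1ℙ) → P M
  step M rec (no none) k dim =
    trans (cong₂ ℕ._+_ (dimension-unique dim (Ker-pivotless M none)) (rank-pivotless M none))
          (ℕ.+-identityʳ n)
  step M rec (yes (i , j , pivot)) k dim = begin
    k ℕ.+ rank M            ≡⟨ cong (k ℕ.+_) (rank-wedderburn M pivot) ⟩
    k ℕ.+ suc (rank M′)     ≡⟨ ℕ.+-suc k (rank M′) ⟩
    suc k ℕ.+ rank M′       ≡⟨ rec M′ (ℕ.≤-reflexive (sym (rank-wedderburn M pivot)))
                                   (suc k) (Ker-wedderburn M pivot dim) ⟩
    n                       ∎
    where
    open ≡-Reasoning
    M′ : Matrix m n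
    M′ = wedderburn M i j

-- Symmetric matrices

-- With u and v the columns `j` and `i` of `M`, the two reductions together add u vᵀ + v uᵀ, which
-- is symmetric with zero diagonal. The rank falls by two.
alternating⇒even-rank : (M : Matrix n n) → IsSymmetric M → (∀ i → M i i ≡ 0ℙ) →
                        parity (rank M) ≡ 0ℙ
alternating⇒even-rank {n} = rank-induction P λ M rec → step M rec (findPivot M)
  where
  P : Matrix n n → Set
  P M = IsSymmetric M → (∀ i → M i i ≡ 0ℙ) → parity (rank M) ≡ 0ℙ

  step : ∀ M → (∀ M′ → rank M′ ℕ.< rank M → P M′) → Dec (∃[ i ] ∃[ j ] M i j ≡ 1ℙ) → P M
  step M rec (no none) M-sym M-alt = cong parity (rank-pivotless M none)
  step M rec (yes (i , j , pivot)) M-sym M-alt =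
    -- `parity` recurses in steps of two, so the parity of `suc (suc r)` reduces to that of `r`.
    trans (cong parity rank≡) (rec M″ (ℕ.<⇒≤ (ℕ.≤-reflexive (sym rank≡))) M″-sym M″-alt)
    where
    M′ M″ : Matrix n n
    M′ = wedderburn M i j
    M″ = wedderburn M′ j i

    M″-entry : ∀ a b → M″ a b ≡ M a b + (M a j * M i b + M a i * M j b)
    -- Since `M i i` and `M j j` vanish, column `i` and row `j` of `M′` agree with those of `M`.
    M″-entry a b rewrite M-alt i | M-alt j | zeroʳ (M a j) | +-identityʳ (M a i)
                       | +-identityʳ (M j b) = +-assoc (M a b) _ _

    pivot′ : M′ j i ≡ 1ℙ
    pivot′ rewrite M-alt i | M-alt j = trans (+-identityʳ (M j i)) (trans (M-sym j i) pivot)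

    rank≡ : rank M ≡ suc (suc (rank M″))
    rank≡ = trans (rank-wedderburn M pivot) (cong suc (rank-wedderburn M′ pivot′))

    swap : ∀ a b c d → a * b + c * d ≡ d * c + b * a
    swap a b c d = trans (+-comm (a * b) (c * d)) (cong₂ _+_ (*-comm c d) (*-comm a b))

    M″-sym : IsSymmetric M″
    M″-sym a b = begin
      M″ a b                                       ≡⟨ M″-entry a b ⟩
      M a b + (M a j * M i b + M a i * M j b)
        ≡⟨ cong₂ _+_ (M-sym a b)
          (cong₂ _+_ (cong₂ _*_ (M-sym a j) (M-sym i b))
                     (cong₂ _*_ (M-sym a i) (M-sym j b))) ⟩
      M b a + (M j a * M b i + M i a * M b j)
        ≡⟨ cong (M b a +_) (swap (M j a) (M b i) (M i a) (M b j)) ⟩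
      M b a + (M b j * M i a + M b i * M j a)      ≡⟨ M″-entry b a ⟨
      M″ b a                                       ∎
      where open ≡-Reasoning

    M″-alt : ∀ a → M″ a a ≡ 0ℙ
    M″-alt a = begin
      M″ a a                                       ≡⟨ M″-entry a a ⟩
      M a a + (M a j * M i a + M a i * M j a)
        ≡⟨ cong₂ (λ p q → p + (M a j * M i a + q)) (M-alt a)
          (trans (cong₂ _*_ (M-sym a i) (M-sym j a)) (*-comm (M i a) (M a j))) ⟩
      M a j * M i a + M a j * M i a                ≡⟨ p+p≡0ℙ (M a j * M i a) ⟩
      0ℙ                                           ∎
      where open ≡-Reasoning

parity-suc : ∀ r → parity (suc r) ≡ 1ℙ + parity r
parity-suc r = trans (sym (⁻¹-involutive (parity (suc r)))) (cong _⁻¹ (suc-homo-⁻¹ r))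

-- Reduction at a diagonal pivot.

module _ (M : Matrix n n) (M-sym : IsSymmetric M) {i} (pivot : M i i ≡ 1ℙ) where

  private
    M′ : Matrix n n
    M′ = wedderburn M i i

  wedderburn-sym : IsSymmetric M′
  wedderburn-sym a b = cong₂ _+_ (M-sym a b)
    (trans (cong₂ _*_ (M-sym a i) (M-sym i b)) (*-comm (M i a) (M b i)))

  -- The diagonal of the rank-one matrix u uᵀ is u itself, because squaring is the identity on the
  -- two-element field.
  diag-wedderburn : ∀ a → diag M′ a ≡ diag M a + M i a
  diag-wedderburn a = cong (M a a +_) (trans (cong (_* M i a) (M-sym a i)) (*-idem (M i a)))

  diag-split : diag M ≗ M i +ᵥ diag M′
  diag-split a = sym (trans (cong (M i a +_) (diag-wedderburn a)) (x+[y+x]≡y (M i a) (M a a)))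

  -- Row i of M x = diag M reads M i ∙ x = 1.
  𝒮-wedderburn : 𝒮 M ⊆ 𝒮 M′
  𝒮-wedderburn {x} Mx≗ a = begin
    (M′ *ᵥ x) a                        ≡⟨ wedderburn-*ᵥ M i i x a ⟩
    (M *ᵥ x) a + M a i * (M *ᵥ x) i
      ≡⟨ cong₂ (λ p q → p + M a i * q) (Mx≗ a) (trans (Mx≗ i) pivot) ⟩
    M a a + M a i * 1ℙ
      ≡⟨ cong (M a a +_) (trans (*-identityʳ (M a i)) (M-sym a i)) ⟩
    M a a + M i a                      ≡⟨ diag-wedderburn a ⟨
    diag M′ a                          ∎
    where open ≡-Reasoning

  -- With u = M eᵢ and q = (M x)ᵢ, the target is diag M = M′ x + u = M x + (q + 1) u, which is
  -- reached by adding (q + 1) eᵢ to x. Here `⁻¹` is the flip q + 1, not a multiplicative inverse.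
  𝒮-wedderburn-lift : ∀ {x} → x ∈ 𝒮 M′ → (x +ᵥ ((M *ᵥ x) i ⁻¹ ·ᵥ unit i)) ∈ 𝒮 M
  𝒮-wedderburn-lift {x} M′x≗ a = begin
    (M *ᵥ (x +ᵥ (q ⁻¹ ·ᵥ unit i))) a       ≡⟨ *ᵥ-shift M i x (q ⁻¹) a ⟩
    (M *ᵥ x) a + q ⁻¹ * M a i              ≡⟨ cong ((M *ᵥ x) a +_) (⁻¹-*-distrib q (M a i)) ⟩
    (M *ᵥ x) a + (M a i * q + M a i)       ≡⟨ +-assoc ((M *ᵥ x) a) (M a i * q) (M a i) ⟨
    (M *ᵥ x) a + M a i * q + M a i
      ≡⟨ cong (_+ M a i) (trans (sym (wedderburn-*ᵥ M i i x a)) (M′x≗ a)) ⟩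
    diag M′ a + M a i
      ≡⟨ trans (+-comm (diag M′ a) (M a i)) (cong (_+ diag M′ a) (M-sym a i)) ⟩
    M i a + diag M′ a                      ≡⟨ diag-split a ⟨
    diag M a                               ∎
    where
    open ≡-Reasoning
    q : 𝔽₂
    q = (M *ᵥ x) i

    ⁻¹-*-distrib : ∀ q p → q ⁻¹ * p ≡ p * q + p
    ⁻¹-*-distrib 0ℙ p = sym (cong (_+ p) (zeroʳ p))
    ⁻¹-*-distrib 1ℙ p = sym (trans (cong (_+ p) (*-identityʳ p)) (p+p≡0ℙ p))

  diag-∙-wedderburn : ∀ {x} → x ∈ 𝒮 M → diag M ∙ x ≡ 1ℙ + diag M′ ∙ x
  diag-∙-wedderburn {x} Mx≗ = begin
    diag M ∙ x                  ≡⟨ ∙-cong diag-split (λ _ → refl) ⟩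
    (M i +ᵥ diag M′) ∙ x        ≡⟨ ∙-distribʳ-+ᵥ (M i) (diag M′) x ⟩
    M i ∙ x + diag M′ ∙ x       ≡⟨ cong (_+ diag M′ ∙ x) (trans (Mx≗ i) pivot) ⟩
    1ℙ + diag M′ ∙ x            ∎
    where open ≡-Reasoning

-- Solvability, parity and the affine structure.

𝒮-solvable×parity : (M : Matrix n n) → IsSymmetric M →
                    ∃ (𝒮 M) × (∀ x → x ∈ 𝒮 M → diag M ∙ x ≡ parity (rank M))
𝒮-solvable×parity {n} = rank-induction P λ M rec → step M rec (any? λ i → M i i ≟ 1ℙ)
  where
  P : Matrix n n → Set
  P M = IsSymmetric M → ∃ (𝒮 M) × (∀ x → x ∈ 𝒮 M → diag M ∙ x ≡ parity (rank M))

  step : ∀ M → (∀ M′ → rank M′ ℕ.< rank M → P M′) → Dec (∃[ i ] M i i ≡ 1ℙ) → P M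
  step M rec (no none) M-sym =
    -- With zero diagonal the system is homogeneous, so the zero vector solves it, and the parity
    -- claim says that the rank is even.
    (0ᵥ , λ i → trans (∙-zeroʳ (M i)) (sym (M-alt i))) ,
    λ x _ → trans (trans (∙-cong M-alt (λ _ → refl)) (∙-zeroˡ x))
                  (sym (alternating⇒even-rank M M-sym M-alt))
    where
    M-alt : ∀ i → M i i ≡ 0ℙ
    M-alt i = ¬1⇒0 λ Mii≡1 → none (i , Mii≡1)
  step M rec (yes (i , pivot)) M-sym =
    (_ , 𝒮-wedderburn-lift M M-sym pivot (proj₂ (proj₁ ih))) , λ x x∈ → begin
      diag M ∙ x              ≡⟨ diag-∙-wedderburn M M-sym pivot x∈ ⟩
      1ℙ + diag M′ ∙ x        ≡⟨ cong (1ℙ +_) (proj₂ ih x (𝒮-wedderburn M M-sym pivot x∈)) ⟩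
      1ℙ + parity (rank M′)   ≡⟨ parity-suc (rank M′) ⟨
      parity (suc (rank M′))  ≡⟨ cong parity (rank-wedderburn M pivot) ⟨
      parity (rank M)         ∎
    where
    open ≡-Reasoning
    M′ : Matrix n n
    M′ = wedderburn M i i

    ih : ∃ (𝒮 M′) × (∀ x → x ∈ 𝒮 M′ → diag M′ ∙ x ≡ parity (rank M′))
    ih = rec M′ (ℕ.≤-reflexive (sym (rank-wedderburn M pivot))) (wedderburn-sym M M-sym pivot)

-- The solutions form the coset of `Ker M` through `x₀`, and rank-nullity gives the dimension.
𝒮-affine : (M : Matrix n n) {x₀ : Vector 𝔽₂ n} → x₀ ∈ 𝒮 M →
           IsAffineSubspaceOfDim (𝒮 M) (n ∸ rank M)
𝒮-affine {n} M {x₀} Mx₀≗ = record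
  { base          = x₀
  ; base-mem      = Mx₀≗
  ; direction     = Ker M
  ; isSubspace    = Ker-isSubspace M
  ; hasDimension  = subst (HasDimension (Ker M)) nullity (proj₂ (Ker-dimension M))
  ; mem⇔direction = λ x → mk⇔
      -- Negation in the field is the identity, so `x -ᵥ x₀` computes to `x +ᵥ x₀`.
      (λ Mx≗ i → trans (∙-distribˡ-+ᵥ (M i) x x₀)
                   (trans (cong₂ _+_ (Mx≗ i) (Mx₀≗ i)) (p+p≡0ℙ (M i i))))
      (λ M[x-x₀]≗0 i → trans
        (+≡0⇒≡ (M i ∙ x) (M i ∙ x₀) (trans (sym (∙-distribˡ-+ᵥ (M i) x x₀)) (M[x-x₀]≗0 i)))
        (Mx₀≗ i))
  }
  where
  nullity : proj₁ (Ker-dimension M) ≡ n ∸ rank M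
  nullity = trans (sym (ℕ.m+n∸n≡m _ (rank M)))
                  (cong (_∸ rank M) (rank-nullity M (proj₂ (Ker-dimension M))))

theorem1p1 : ∀ (n : ℕ) (M : Matrix n n) → IsSymmetric M →
    (diag M ∈ Im M)
    × Satisfiable (𝒮 M)
    × IsAffineSubspaceOfDim (𝒮 M) (n ∸ rank M)
    × (∀ x → x ∈ 𝒮 M → diag M ∙ x ≡ parity (rank M))
theorem1p1 n M M-sym = let ((x₀ , Mx₀≗) , parity≡) = 𝒮-solvable×parity M M-sym in
  IsSubspace.resp-≗ (Span-isSubspace (transpose M)) Mx₀≗ (*ᵥ∈Im M x₀) ,
  (x₀ , Mx₀≗) ,
  𝒮-affine M Mx₀≗ ,
  parity≡
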